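{- For every positive integer $n$, the quadruples of statistics $(T_1,T_2,T_3,S_{17})$ and $(T_2,T_1,T_3,S_{17})$ are equidistributed over the symmetric group $\mathfrak S_n$; that is, for all integers $a,b,c,d$, $$\#\{p\in\mathfrak S_n:(T_1,T_2,T_3,S_{17})(p)=(a,b,c,d)\}=\#\{p\in\mathfrak S_n:(T_2,T_1,T_3,S_{17})(p)=(a,b,c,d)\}.$$
   Context: For $p=p_1p_2\cdots p_n\in\mathfrak S_n$ in one-line notation, with $\mathbb O$ and $\mathbb E$ the sets of odd and even positive integers: $T_1(p)=|\{i\in[n-1]:p_i>p_{i+1},\ p_i\in\mathbb O,\ p_{i+1}\in\mathbb E\}|$; $T_2(p)=|\{i\in[n-1]:p_i<p_{i+1}\text{ and }p_i,p_{i+1}\in\mathbb O\}|$; $T_3(p)=|\{i\in[n-1]:p_i>p_{i+1}\text{ and }p_i,p_{i+1}\in\mathbb O\}|$; $S_{17}(p)$ is the largest $i\in[n]$ such that the elements $1,2,\dots,i$ appear in this order from left to right in $p$. -}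

module Defs where

open import Data.Empty using (⊥-elim)
open import Data.Fin as Fin using (Fin; zero; suc; toℕ; inject₁)
open import Data.Fin.Permutation using (Permutation′; _≈_; _⟨$⟩ʳ_; id; insert; remove; insert-punchIn; insert-remove)
import Data.Fin.Properties as Fin
open import Data.Integer as ℤ using (ℤ; +_)
open import Data.List using (List; []; _∷_; length; filter; allFin; applyUpTo; cartesianProductWith)
open import Data.List.Extrema.Nat using (max; argmax-sel; xs≤max)
open import Data.List.Membership.Propositional.Properties using (∈-filter⁺; ∈-filter⁻; ∈-applyUpTo⁺; ∈-applyUpTo⁻; ∈-allFin)
open import Data.List.Membership.Setoid.Properties using (∈-cartesianProductWith⁺; ∈-resp-≈)
open import Data.List.Relation.Unary.All as All using ([])
open import Data.List.Relation.Unary.AllPairs using ([]; _∷_)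
open import Data.List.Relation.Unary.Any using (here)
open import Data.List.Relation.Unary.Enumerates.Setoid using (IsEnumeration)
open import Data.List.Relation.Unary.Unique.Setoid using (Unique)
open import Data.List.Relation.Unary.Unique.Setoid.Properties using (cartesianProductWith⁺)
open import Data.List.Relation.Unary.Unique.Propositional.Properties using (allFin⁺)
open import Data.Nat using (ℕ; zero; suc; _≤_; _<_; _>_; _<?_; _>?_; _≤?_; z≤n; s≤s)
open import Data.Nat.Divisibility using (_∣_; _∤_; _∣?_)
import Data.Nat.Properties as ℕ
open import Data.Product using (_×_; _,_)
open import Data.Product.Properties using (≡-dec)
open import Data.Sum using (inj₁; inj₂)
open import Level using (Level; 0ℓ)
open import Relation.Binary.Bundles using (Setoid)
open import Relation.Binary.Definitions using (DecidableEquality)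
open import Relation.Binary.PropositionalEquality using (_≡_; refl; sym; trans; cong; subst; setoid)
open import Relation.Nullary using (Dec)
open import Relation.Nullary.Decidable using (_×-dec_; _→-dec_; ¬?)
open import Relation.Unary using (Pred; Decidable)

private
  variable
    a ℓ : Level
    A : Set a
    m n : ℕ

-- Number of entries of a list satisfying P.  On a duplicate-free list this is
-- the cardinality of the set of entries that satisfy P.
# : {P : Pred A ℓ} → Decidable P → List A → ℕ
# P? xs = length (filter P? xs)

-- Permutations are compared by _≈_, since two bijections with the same
-- values need not be propositionally equal as records.
permutationSetoid : ℕ → Setoid 0ℓ 0ℓ
permutationSetoid n = record
  { Carrier       = Permutation′ n
  ; _≈_           = _≈_
  ; isEquivalence = record
    { refl  = λ _ → refl
    ; sym   = λ e i → sym (e i)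
    ; trans = λ e f i → trans (e i) (f i)
    }
  }

-- The symmetric group as a list: choose the value at the first position, then
-- the relative order of the others.  The two lemmas below show that every
-- permutation occurs, up to _≈_, exactly once.
𝔖 : (n : ℕ) → List (Permutation′ n)
𝔖 zero    = id ∷ []
𝔖 (suc n) = cartesianProductWith (insert zero) (allFin (suc n)) (𝔖 n)

private
  insert-cong : ∀ {j k : Fin (suc n)} {p q : Permutation′ n} →
                j ≡ k → p ≈ q → insert zero j p ≈ insert zero k q
  insert-cong refl e zero = refl
  insert-cong {j = j} {p = p} {q = q} refl e (suc i) =
    trans (insert-punchIn zero j p i)
      (trans (cong (Fin.punchIn j) (e i)) (sym (insert-punchIn zero j q i)))

  insert-injective : ∀ {j k : Fin (suc n)} {p q : Permutation′ n} →
                     insert zero j p ≈ insert zero k q → j ≡ k × p ≈ q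
  insert-injective {j = j} {k} {p} {q} e with refl ← e zero =
    refl , λ i → Fin.punchIn-injective j _ _
      (trans (sym (insert-punchIn zero j p i))
        (trans (e (suc i)) (insert-punchIn zero j q i)))

𝔖-complete : ∀ n → IsEnumeration (permutationSetoid n) (𝔖 n)
𝔖-complete zero    p = here λ ()
𝔖-complete (suc n) p =
  ∈-resp-≈ (permutationSetoid (suc n))
    {x = insert zero (p ⟨$⟩ʳ zero) (remove zero p)} {y = p} (insert-remove zero p)
    (∈-cartesianProductWith⁺ (setoid _) (permutationSetoid n) (permutationSetoid (suc n))
      (λ {_} {_} {q} {r} → insert-cong {p = q} {q = r})
      (∈-allFin (p ⟨$⟩ʳ zero)) (𝔖-complete n (remove zero p)))

𝔖-unique : ∀ n → Unique (permutationSetoid n) (𝔖 n)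
𝔖-unique zero    = [] ∷ []
𝔖-unique (suc n) =
  cartesianProductWith⁺ (setoid _) (permutationSetoid n) (permutationSetoid (suc n))
    (insert zero) (λ {_} {_} {p} {q} → insert-injective {p = p} {q = q}) (allFin⁺ (suc n)) (𝔖-unique n)

-- Positions and values of a Permutation′ n start at 0, while the letters of
-- the one-line notation p₁p₂⋯pₙ are 1, …, n.  Only the letters need the shift:
-- it affects their parity.
letter : Permutation′ n → Fin n → ℕ
letter p i = suc (toℕ (p ⟨$⟩ʳ i))

Odd Even : Pred ℕ 0ℓ
Odd  k = 2 ∤ k
Even k = 2 ∣ k

odd? : Decidable Odd
odd? k = ¬? (2 ∣? k)

even? : Decidable Even
even? k = 2 ∣? k

-- For p of size n = suc m, i : Fin m stands for an index in [n - 1]; the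
-- letters pᵢ and pᵢ₊₁ are then at positions inject₁ i and suc i.
module _ (p : Permutation′ (suc m)) (i : Fin m) where
  private
    x = letter p (inject₁ i)
    y = letter p (suc i)

  OddEvenDescent OddOddAscent OddOddDescent : Set
  OddEvenDescent = x > y × Odd x × Even y
  OddOddAscent   = x < y × Odd x × Odd y
  OddOddDescent  = x > y × Odd x × Odd y

  oddEvenDescent? : Dec OddEvenDescent
  oddEvenDescent? = x >? y ×-dec odd? x ×-dec even? y

  oddOddAscent? : Dec OddOddAscent
  oddOddAscent? = x <? y ×-dec odd? x ×-dec odd? y

  oddOddDescent? : Dec OddOddDescent
  oddOddDescent? = x >? y ×-dec odd? x ×-dec odd? y

T₁ T₂ T₃ : Permutation′ (suc m) → ℕ
T₁ {m} p = # (oddEvenDescent? p) (allFin m)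
T₂ {m} p = # (oddOddAscent?   p) (allFin m)
T₃ {m} p = # (oddOddDescent?  p) (allFin m)

-- The letters 1, 2, …, k occur in this order from left to right.
InOrder : Permutation′ n → ℕ → Set
InOrder {n} p k = ∀ (i j : Fin n) → letter p i < letter p j → letter p j ≤ k → i Fin.< j

inOrder? : (p : Permutation′ n) → Decidable (InOrder p)
inOrder? p k = Fin.all? λ i → Fin.all? λ j →
  letter p i <? letter p j →-dec letter p j ≤? k →-dec i Fin.<? j

-- The default value 0 is never returned when n is positive, because k = 1
-- always qualifies: see S₁₇-inOrder.
S₁₇ : Permutation′ n → ℕ
S₁₇ {n} p = max 0 (filter (inOrder? p) (applyUpTo suc n))

private
  inOrder-one : (p : Permutation′ n) → InOrder p 1
  inOrder-one p i j (s≤s lt) (s≤s le) = ⊥-elim (ℕ.n≮0 (ℕ.<-≤-trans lt le))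

S₁₇-maximal : (p : Permutation′ n) → ∀ {k} → 1 ≤ k → k ≤ n → InOrder p k → k ≤ S₁₇ p
S₁₇-maximal {n} p {suc k} 1≤k k≤n ord =
  All.lookup (xs≤max 0 (filter (inOrder? p) (applyUpTo suc n)))
    (∈-filter⁺ (inOrder? p) (∈-applyUpTo⁺ suc k≤n) ord)

S₁₇-inOrder : (p : Permutation′ (suc m)) → 1 ≤ S₁₇ p × S₁₇ p ≤ suc m × InOrder p (S₁₇ p)
S₁₇-inOrder {m} p
  with argmax-sel (λ k → k) 0 (filter (inOrder? p) (applyUpTo suc (suc m)))
... | inj₁ max≡0 = ⊥-elim (ℕ.n≮0 (subst (1 ≤_) max≡0
                     (S₁₇-maximal p (s≤s z≤n) (s≤s z≤n) (inOrder-one p))))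
... | inj₂ max∈ with ∈-filter⁻ (inOrder? p) {xs = applyUpTo suc (suc m)} max∈
... | max∈[n] , ord with ∈-applyUpTo⁻ suc max∈[n]
... | k , k<n , max≡suck =
  subst (1 ≤_) (sym max≡suck) (s≤s z≤n) , subst (_≤ suc m) (sym max≡suck) k<n , ord

ℤ⁴ : Set
ℤ⁴ = ℤ × ℤ × ℤ × ℤ

_≟⁴_ : DecidableEquality ℤ⁴
_≟⁴_ = ≡-dec ℤ._≟_ (≡-dec ℤ._≟_ (≡-dec ℤ._≟_ ℤ._≟_))

⟨_,_,_,_⟩ : (f g h k : A → ℕ) → A → ℤ⁴
⟨ f , g , h , k ⟩ p = + f p , + g p , + h p , + k p

{-# OPTIONS --safe #-}
module Submission where

-- Build permutations by inserting the letters 1, 2, 3, … one after the other.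
-- Let s record (T₁, T₂, T₃) and the parity of the last letter of a word with
-- letters 1, …, n.  The multiset of values of s after inserting n + 1 in all
-- possible ways depends only on s and n, and this dependence commutes with
-- exchanging T₁ and T₂: an even letter destroys each counted pair once, and an
-- odd letter meets equally many odd and even letters, which balances the
-- gaps that raise T₁ and those that raise T₂.  Insertions of letters larger than
-- d preserve the condition S₁₇ ≥ d.  So for each d the recursion can be run from
-- the word 1 2 ⋯ d, where T₁ = T₂ = 0, and (T₁, T₂, T₃) is equidistributed with
-- (T₂, T₁, T₃) on S₁₇ ≥ d, hence on S₁₇ = d.

open import Defs
open import Data.Bool using (Bool; true; false; not; _∧_)
open import Data.Fin as Fin using (Fin; zero; suc; inject₁)
open import Data.Fin.Permutation using (Permutation′; _⟨$⟩ʳ_)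
import Data.Fin.Properties as Fin
open import Data.Integer as ℤ using (ℤ; ∣_∣)
open import Data.List
  using (List; []; _∷_; _++_; length; map; concatMap; tabulate; allFin; applyUpTo; applyDownFrom;
         cartesianProductWith)
open import Data.List.Membership.Propositional using (_∈_)
open import Data.List.Membership.Propositional.Properties
  using (∈-∃++; ∈-++⁻; ∈-++⁺ˡ; ∈-++⁺ʳ; ∈-map⁺; ∈-map⁻; ∈-concatMap⁺; ∈-concatMap⁻; ∈-tabulate⁻;
         ∈-applyDownFrom⁺)
open import Data.List.Properties
  using (length-map; length-++; length-++-sucʳ; length-tabulate; length-applyDownFrom; map-∘;
         map-++; map-tabulate; reverse-applyUpTo; ∷-injective)
open import Data.List.Relation.Binary.Permutation.Propositional
  using (_↭_; prep; swap; ↭-refl; ↭-sym; ↭-trans; ↭-reflexive; ↭⇒↭ₛ)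
open import Data.List.Relation.Binary.Permutation.Propositional.Properties
  using (drop-mid; shift; map⁺; All-resp-↭; ↭-length; ↭-reverse; filter-↭; ∈-resp-↭)
open import Data.List.Relation.Binary.Pointwise using (Pointwise-≡⇒≡)
open import Data.List.Relation.Binary.Subset.Propositional using (_⊆_)
open import Data.List.Relation.Unary.All as All using (All; []; _∷_)
import Data.List.Relation.Unary.All.Properties as All
open import Data.List.Relation.Unary.AllPairs as AllPairs using (AllPairs; []; _∷_)
import Data.List.Relation.Unary.AllPairs.Properties as AllPairs
open import Data.List.Relation.Unary.Any using (here; there)
import Data.List.Relation.Unary.Any as Any
open import Data.List.Relation.Unary.Sorted.TotalOrder.Properties
  using (AllPairs⇒Sorted; applyUpTo⁺₂; ↗↭↗⇒≋)
open import Data.List.Relation.Unary.Unique.Propositional using (Unique)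
import Data.List.Relation.Unary.Unique.Propositional.Properties as Unique
open import Data.Nat
  using (ℕ; zero; suc; _+_; _*_; _≤_; _<_; _≤?_; _<?_; _≟_; z≤n; s≤s; pred; _≤′_; ≤′-refl; ≤′-step)
import Data.Nat.Divisibility as ∣
open import Data.Nat.ListAction using (sum)
open import Data.Nat.ListAction.Properties using (sum-++; sum-↭)
import Data.Nat.Properties as ℕ
open import Data.Nat.Tactic.RingSolver using (solve-∀)
open import Data.Product using (_,_; proj₁; proj₂; ∃)
open import Data.Sum using (_⊎_; inj₁; inj₂)
open import Function using (_∘_; _⇔_; mk⇔; Injection; Equivalence)
open import Function.Construct.Composition using (_⇔-∘_)
open import Function.Properties.Inverse using (↔⇒↣)
open import Level using (Level)
open import Relation.Binary using (tri<; tri≈; tri>)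
open import Relation.Binary.PropositionalEquality
  using (_≡_; _≢_; refl; sym; trans; cong; cong₂; subst; module ≡-Reasoning)
open import Relation.Nullary using (Dec; yes; no; does; contradiction)
open import Relation.Nullary.Decidable using (does-⇔; dec-true; dec-false; _×-dec_; _→-dec_)
open import Relation.Unary using (Pred; Decidable)

private
  variable
    a ℓ : Level
    A B C : Set a
    n : ℕ

-- Indicators, finite sums and counting.

bit : Bool → ℕ
bit true  = 1
bit false = 0

𝟙 : {P : Set ℓ} → Dec P → ℕ
𝟙 P? = bit (does P?)

𝟙-⇔ : {P Q : Set ℓ} → P ⇔ Q → (P? : Dec P) (Q? : Dec Q) → 𝟙 P? ≡ 𝟙 Q?
𝟙-⇔ P⇔Q P? Q? = cong bit (does-⇔ P⇔Q P? Q?)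

∑ : List A → (A → ℕ) → ℕ
∑ xs f = sum (map f xs)

∑-cong : {f g : A → ℕ} (xs : List A) → (∀ {x} → x ∈ xs → f x ≡ g x) → ∑ xs f ≡ ∑ xs g
∑-cong []       e = refl
∑-cong (x ∷ xs) e = cong₂ _+_ (e (here refl)) (∑-cong xs (e ∘ there))

∑-+ : (f g : A → ℕ) (xs : List A) → ∑ xs (λ x → f x + g x) ≡ ∑ xs f + ∑ xs g
∑-+ f g []       = refl
∑-+ f g (x ∷ xs) = trans (cong (_+_ (f x + g x)) (∑-+ f g xs)) (interchange (f x) (g x) _ _)
  where
  interchange : ∀ i j k l → i + j + (k + l) ≡ i + k + (j + l)
  interchange = solve-∀

∑-* : (c : ℕ) (f : A → ℕ) (xs : List A) → ∑ xs (λ x → c * f x) ≡ c * ∑ xs f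
∑-* c f []       = sym (ℕ.*-zeroʳ c)
∑-* c f (x ∷ xs) = trans (cong (c * f x +_) (∑-* c f xs)) (sym (ℕ.*-distribˡ-+ c (f x) (∑ xs f)))

∑-map : (f : B → ℕ) (g : A → B) (xs : List A) → ∑ (map g xs) f ≡ ∑ xs (f ∘ g)
∑-map f g xs = cong sum (sym (map-∘ xs))

∑-concatMap : (f : B → ℕ) (g : A → List B) (xs : List A) →
              ∑ (concatMap g xs) f ≡ ∑ xs (λ x → ∑ (g x) f)
∑-concatMap f g []       = refl
∑-concatMap f g (x ∷ xs) = begin
  sum (map f (g x ++ concatMap g xs))          ≡⟨ cong sum (map-++ f (g x) _) ⟩
  sum (map f (g x) ++ map f (concatMap g xs))  ≡⟨ sum-++ (map f (g x)) _ ⟩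
  ∑ (g x) f + ∑ (concatMap g xs) f             ≡⟨ cong (∑ (g x) f +_) (∑-concatMap f g xs) ⟩
  ∑ (g x) f + ∑ xs (λ y → ∑ (g y) f)           ∎
  where open ≡-Reasoning

∑-↭ : (f : A → ℕ) {xs ys : List A} → xs ↭ ys → ∑ xs f ≡ ∑ ys f
∑-↭ f e = sum-↭ (map⁺ f e)

∑-const : (c : ℕ) (xs : List A) → ∑ xs (λ _ → c) ≡ length xs * c
∑-const c []       = refl
∑-const c (x ∷ xs) = cong (c +_) (∑-const c xs)

#-∷ : {P : Pred A ℓ} (P? : Decidable P) (x : A) (xs : List A) →
      # P? (x ∷ xs) ≡ 𝟙 (P? x) + # P? xs
#-∷ P? x xs with does (P? x)
... | true  = refl
... | false = refl

#≡∑ : {P : Pred A ℓ} (P? : Decidable P) (xs : List A) → # P? xs ≡ ∑ xs (𝟙 ∘ P?)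
#≡∑ P? []       = refl
#≡∑ P? (x ∷ xs) = trans (#-∷ P? x xs) (cong (𝟙 (P? x) +_) (#≡∑ P? xs))

#-map : {P : Pred B ℓ} (P? : Decidable P) (f : A → B) (xs : List A) →
        # P? (map f xs) ≡ # (P? ∘ f) xs
#-map P? f xs = trans (#≡∑ P? (map f xs)) (trans (∑-map _ f xs) (sym (#≡∑ (P? ∘ f) xs)))

-- Rearrangements of a list by repeated insertion.

inserts : A → List A → List (List A)
inserts x []       = (x ∷ []) ∷ []
inserts x (y ∷ ys) = (x ∷ y ∷ ys) ∷ map (y ∷_) (inserts x ys)

rearrangements : List A → List (List A)
rearrangements []       = [] ∷ []
rearrangements (x ∷ xs) = concatMap (inserts x) (rearrangements xs)

length-inserts : (x : A) (ys : List A) → length (inserts x ys) ≡ suc (length ys)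
length-inserts x []       = refl
length-inserts x (y ∷ ys) = cong suc (trans (length-map (y ∷_) (inserts x ys)) (length-inserts x ys))

∈-inserts⁺ : (x : A) (ys zs : List A) → ys ++ x ∷ zs ∈ inserts x (ys ++ zs)
∈-inserts⁺ x []       []       = here refl
∈-inserts⁺ x []       (z ∷ zs) = here refl
∈-inserts⁺ x (y ∷ ys) zs       = there (∈-map⁺ (y ∷_) (∈-inserts⁺ x ys zs))

∈-inserts⁻ : {x : A} (ys : List A) {zs : List A} → zs ∈ inserts x ys → zs ↭ x ∷ ys
∈-inserts⁻ []       (here refl) = ↭-refl
∈-inserts⁻ (y ∷ ys) (here refl) = ↭-refl
∈-inserts⁻ {x = x} (y ∷ ys) (there zs∈) with zs′ , zs′∈ , refl ← ∈-map⁻ (y ∷_) zs∈ =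
  ↭-trans (prep y (∈-inserts⁻ ys zs′∈)) (swap y x ↭-refl)

∈-rearrangements⁺ : (xs : List A) {ys : List A} → ys ↭ xs → ys ∈ rearrangements xs
∈-rearrangements⁺ [] {[]}     e = here refl
∈-rearrangements⁺ [] {y ∷ ys} e with () ← ↭-length e
∈-rearrangements⁺ (x ∷ xs) e
  with us , vs , refl ← ∈-∃++ (∈-resp-↭ (↭-sym e) (here refl)) =
  ∈-concatMap⁺ (inserts x) (Any.map (λ { refl → ∈-inserts⁺ x us vs })
    (∈-rearrangements⁺ xs (drop-mid us [] e)))

∈-rearrangements⁻ : (xs : List A) {ys : List A} → ys ∈ rearrangements xs → ys ↭ xs
∈-rearrangements⁻ []       (here refl) = ↭-refl
∈-rearrangements⁻ (x ∷ xs) ys∈ = go (rearrangements xs) (∈-rearrangements⁻ xs) (∈-concatMap⁻ (inserts x) ys∈)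
  where
  go : ∀ zss {ys} → (∀ {zs} → zs ∈ zss → zs ↭ xs) → Any.Any (λ zs → ys ∈ inserts x zs) zss → ys ↭ x ∷ xs
  go (zs ∷ zss) f (here ys∈)  = ↭-trans (∈-inserts⁻ zs ys∈) (prep x (f (here refl)))
  go (zs ∷ zss) f (there ys∈) = go zss (f ∘ there) ys∈

length-rearrangements : (x : A) (xs : List A) →
  length (rearrangements (x ∷ xs)) ≡ length (rearrangements xs) * suc (length xs)
length-rearrangements x xs = begin
  length (rearrangements (x ∷ xs))                                     ≡⟨ ℕ.*-identityʳ _ ⟨
  length (rearrangements (x ∷ xs)) * 1                                 ≡⟨ ∑-const 1 (rearrangements (x ∷ xs)) ⟨
  ∑ (rearrangements (x ∷ xs)) (λ _ → 1)                                ≡⟨ ∑-concatMap _ (inserts x) (rearrangements xs) ⟩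
  ∑ (rearrangements xs) (λ ys → ∑ (inserts x ys) (λ _ → 1))            ≡⟨ ∑-cong (rearrangements xs) count ⟩
  ∑ (rearrangements xs) (λ _ → suc (length xs))                        ≡⟨ ∑-const (suc (length xs)) (rearrangements xs) ⟩
  length (rearrangements xs) * suc (length xs)                         ∎
  where
  open ≡-Reasoning
  count : ∀ {ys} → ys ∈ rearrangements xs → ∑ (inserts x ys) (λ _ → 1) ≡ suc (length xs)
  count {ys} ys∈ = trans (∑-const 1 (inserts x ys)) (trans (ℕ.*-identityʳ _)
    (trans (length-inserts x ys) (cong suc (↭-length (∈-rearrangements⁻ xs ys∈)))))

length-cartesianProductWith : (f : A → B → C) (xs : List A) (ys : List B) →
  length (cartesianProductWith f xs ys) ≡ length xs * length ys
length-cartesianProductWith f []       ys = refl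
length-cartesianProductWith f (x ∷ xs) ys =
  trans (length-++ (map (f x) ys)) (cong₂ _+_ (length-map (f x) ys) (length-cartesianProductWith f xs ys))

-- Pigeonhole: the head of `xs` is found in `ys` and removed from both, which keeps all three
-- hypotheses. Exhaustiveness of a list then needs only one inclusion and a length.
unique∧⊆∧length⇒↭ : {xs ys : List A} → Unique xs → xs ⊆ ys → length ys ≤ length xs → xs ↭ ys
unique∧⊆∧length⇒↭ {ys = []}    []        ⊆ys ∣ys∣≤ = ↭-refl
unique∧⊆∧length⇒↭ {xs = x ∷ xs} (x∉ ∷ xs!) ⊆ys ∣ys∣≤
  with us , vs , refl ← ∈-∃++ (⊆ys (here refl)) =
  ↭-trans (prep x (unique∧⊆∧length⇒↭ xs! xs⊆ ∣us++vs∣≤)) (↭-sym (shift x us vs))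
  where
  xs⊆ : xs ⊆ us ++ vs
  xs⊆ {z} z∈ with ∈-++⁻ us (⊆ys (there z∈))
  ... | inj₁ z∈us         = ∈-++⁺ˡ z∈us
  ... | inj₂ (here refl)  = contradiction refl (All.lookup x∉ z∈)
  ... | inj₂ (there z∈vs) = ∈-++⁺ʳ us z∈vs
  ∣us++vs∣≤ : length (us ++ vs) ≤ length xs
  ∣us++vs∣≤ = ℕ.≤-pred (subst (_≤ suc (length xs)) (length-++-sucʳ us x vs) ∣ys∣≤)

-- Permutations as words.

tabulate-injective : ∀ {n} {f g : Fin n → A} → tabulate f ≡ tabulate g → ∀ i → f i ≡ g i
tabulate-injective e zero    = proj₁ (∷-injective e)
tabulate-injective e (suc i) = tabulate-injective (proj₂ (∷-injective e)) i

AllPairs-tabulate⁻ : {R : A → A → Set ℓ} {f : Fin n → A} →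
                     AllPairs R (tabulate f) → ∀ {i j} → i Fin.< j → R (f i) (f j)
AllPairs-tabulate⁻ (r ∷ rs) {zero}  {suc j} i<j       = All.tabulate⁻ r j
AllPairs-tabulate⁻ (r ∷ rs) {suc i} {suc j} (s≤s i<j) = AllPairs-tabulate⁻ rs i<j

word : Permutation′ n → List ℕ
word p = tabulate (letter p)

-- Descending, so that the head of `letters (suc n)` is its largest letter and `rearrangements`
-- unfolds to the insertion of `suc n` into the words with letters up to `n`.
letters : ℕ → List ℕ
letters = applyDownFrom suc

letter-injective : (p : Permutation′ n) → ∀ {i j} → letter p i ≡ letter p j → i ≡ j
letter-injective p e = Injection.injective (↔⇒↣ p) (Fin.toℕ-injective (ℕ.suc-injective e))

word↭letters : (p : Permutation′ n) → word p ↭ letters n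
word↭letters {n} p = unique∧⊆∧length⇒↭ (Unique.tabulate⁺ (letter-injective p)) word⊆
  (ℕ.≤-reflexive (trans (length-applyDownFrom suc n) (sym (length-tabulate (letter p)))))
  where
  word⊆ : word p ⊆ letters n
  word⊆ x∈ with i , refl ← ∈-tabulate⁻ x∈ = ∈-applyDownFrom⁺ suc (Fin.toℕ<n (p ⟨$⟩ʳ i))

length-𝔖 : ∀ n → length (𝔖 n) ≡ length (rearrangements (letters n))
length-𝔖 zero    = refl
length-𝔖 (suc n) = begin
  length (𝔖 (suc n))                                                 ≡⟨ length-cartesianProductWith _ (allFin (suc n)) (𝔖 n) ⟩
  length (allFin (suc n)) * length (𝔖 n)                             ≡⟨ cong₂ _*_ (length-tabulate {n = suc n} (λ i → i)) (length-𝔖 n) ⟩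
  suc n * length (rearrangements (letters n))                        ≡⟨ ℕ.*-comm (suc n) _ ⟩
  length (rearrangements (letters n)) * suc n                        ≡⟨ cong (λ k → length (rearrangements (letters n)) * suc k) (length-applyDownFrom suc n) ⟨
  length (rearrangements (letters n)) * suc (length (letters n))     ≡⟨ length-rearrangements (suc n) (letters n) ⟨
  length (rearrangements (letters (suc n)))                          ∎
  where open ≡-Reasoning

-- `𝔖` recurses on the first position, `rearrangements` on the largest letter, so the lists are
-- compared by counting: distinct permutations have distinct words, every word is a rearrangement,
-- and both lengths gain the factor `suc n` at each step.
words↭rearrangements : ∀ n → map word (𝔖 n) ↭ rearrangements (letters n)
words↭rearrangements n = unique∧⊆∧length⇒↭
  (AllPairs.map⁺ (AllPairs.map (λ p≉q e → p≉q λ i → Fin.toℕ-injective (ℕ.suc-injective (tabulate-injective e i))) (𝔖-unique n)))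
  (λ w∈ → let p , _ , w≡ = ∈-map⁻ word w∈ in ∈-rearrangements⁺ (letters n) (↭-trans (↭-reflexive w≡) (word↭letters p)))
  (ℕ.≤-reflexive (trans (sym (length-𝔖 n)) (sym (length-map word (𝔖 n)))))

-- States of words.

-- The fields stand for T₁, T₂, T₃ of a word and for its last letter being odd.
record State : Set where
  constructor state
  field
    odd↘even odd↗odd odd↘odd : ℕ
    endsOdd : Bool
open State

inc₁ inc₂ inc₃ dec₁ dec₂ dec₃ exchange : State → State
inc₁ s = record s { odd↘even = suc (odd↘even s) }
inc₂ s = record s { odd↗odd  = suc (odd↗odd s) }
inc₃ s = record s { odd↘odd  = suc (odd↘odd s) }
dec₁ s = record s { odd↘even = pred (odd↘even s) }
dec₂ s = record s { odd↗odd  = pred (odd↗odd s) }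
dec₃ s = record s { odd↘odd  = pred (odd↘odd s) }
exchange s = record s { odd↘even = odd↗odd s ; odd↗odd = odd↘even s }

ending : Bool → State → State
ending b s = record s { endsOdd = b }

-- The arguments tell whether x is even, y is even, and y < x for adjacent letters x y.
link : Bool → Bool → Bool → State → State
link false false true  = inc₃
link false false false = inc₂
link false true  true  = inc₁
link _     _     _     = λ s → s

edge : ℕ → ℕ → State → State
edge x y = link (does (even? x)) (does (even? y)) (does (y <? x))

-- stateAfter x w describes the word x w.  A word w is treated as 0 w: the
-- letter 0 is even and smaller than every letter, so it creates no pair that
-- is counted, and the gap in front of w needs no separate treatment.
stateAfter : ℕ → List ℕ → State
stateAfter x []      = state 0 0 0 (does (odd? x))
stateAfter x (y ∷ w) = edge x y (stateAfter y w)

wordState : List ℕ → State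
wordState = stateAfter 0

-- Gain and loss under insertion, and their symmetry.

-- When the next letter is inserted in all gaps of a word with state s, the sum
-- of f over the new states is gain f s - loss f s.  For an odd letter, k is the
-- number of odd and also of even letters of the word; for an even letter, k is
-- its length.  In evenGain the junk value of dec at 0 has coefficient 0.
oddLoss evenLoss : (State → ℕ) → State → ℕ
oddLoss f s =
  odd↘odd s * f (inc₃ s) +
  (odd↘even s + odd↗odd s + odd↘odd s + bit (endsOdd s)) * f (inc₁ (inc₂ s))
evenLoss f s = (odd↘even s + odd↗odd s + odd↘odd s) * f s

oddGain evenGain : ℕ → (State → ℕ) → State → ℕ
oddGain k f s =
  (odd↘even s + odd↘odd s + bit (endsOdd s)) * f (inc₂ s) +
  (odd↗odd s + odd↘odd s + bit (endsOdd s)) * f (inc₁ s) +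
  k * f (inc₃ s) + k * f (inc₁ (inc₂ s)) +
  bit (not (endsOdd s)) * f (ending true s)
evenGain k f s =
  k * f s + (odd↘even s * f (dec₁ s) + odd↗odd s * f (dec₂ s) + odd↘odd s * f (dec₃ s)) +
  f (ending false s)

-- `exchange` commutes definitionally with `inc₃` and `inc₁ ∘ inc₂`, and the coefficients contain
-- `odd↘even` and `odd↗odd` only through their sum.
oddLoss-exchange : ∀ f s → oddLoss (f ∘ exchange) s ≡ oddLoss f (exchange s)
oddLoss-exchange f (state i j k b) =
  cong (λ l → k * f (inc₃ s) + (l + k + bit b) * f (inc₁ (inc₂ s))) (ℕ.+-comm i j)
  where s = state j i k b

evenLoss-exchange : ∀ f s → evenLoss (f ∘ exchange) s ≡ evenLoss f (exchange s)
evenLoss-exchange f (state i j k b) = cong (λ l → (l + k) * f (state j i k b)) (ℕ.+-comm i j)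

-- The coefficients of `inc₁` and `inc₂` arise from each other by swapping two counters, so
-- `exchange` only permutes these two summands.
oddGain-exchange : ∀ m f s → oddGain m (f ∘ exchange) s ≡ oddGain m f (exchange s)
oddGain-exchange m f s =
  cong (λ l → l + m * f (inc₃ t) + m * f (inc₁ (inc₂ t)) + bit (not (endsOdd s)) * f (ending true t))
    (ℕ.+-comm ((odd↘even s + odd↘odd s + bit (endsOdd s)) * f (inc₁ t)) _)
  where t = exchange s

evenGain-exchange : ∀ m f s → evenGain m (f ∘ exchange) s ≡ evenGain m f (exchange s)
evenGain-exchange m f s =
  cong (λ l → m * f t + (l + odd↘odd s * f (dec₃ t)) + f (ending false t))
    (ℕ.+-comm (odd↘even s * f (dec₂ t)) _)
  where t = exchange s

-- Insertion of a large odd letter.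

-- The intended I is the sum of f over the states of the words obtained by inserting a
-- large odd letter in a word y w with state s; k, e and o count the odd letters of
-- y w, the even letters of w and the odd letters of w.
OddInsertion : (State → ℕ) → State → (I k e o : ℕ) → Set
OddInsertion f s I k e o =
  I + (odd↘odd s * f (inc₃ s) +
       (odd↘even s + odd↗odd s + odd↘odd s + bit (endsOdd s)) * f (inc₁ (inc₂ s)) +
       k * f (inc₁ s)) ≡
  (odd↘even s + odd↘odd s + bit (endsOdd s)) * f (inc₂ s) +
  (odd↗odd s + odd↘odd s + bit (endsOdd s) + e) * f (inc₁ s) +
  o * f (inc₃ s) + k * f (inc₁ (inc₂ s)) + bit (not (endsOdd s)) * f (ending true s)

-- Here `b`, `c`, `d` describe the pair `y z` when `y` is put in front of `z w`. The added summand
-- belongs to the gap between `y` and `z`; all other insertions keep this pair, hence the hypothesis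
-- for `f ∘ link b c d`.
oddInsertion-∷ : ∀ b c d f s I k e o → OddInsertion (f ∘ link b c d) s I k e o →
  OddInsertion f (link b c d s) (f (link b false false (link false c true s)) + I)
    (bit (not b) + k) (bit c + e) (bit (not c) + o)
oddInsertion-∷ b c d f s I k e o = go b c d
  where
  -- `d₁`, `d₂`, `d₃` are what the pair adds to the counters; `u`, `v`, `v′` are the increments of
  -- `k`, `e`, `o`. The identity for the new gap alone, with the values of `g` as unknowns, is added
  -- to the induction hypothesis.
  extend : ∀ g d₁ d₂ d₃ u v v′ (new : (p₁ p₂ p₃ p₁₂ : ℕ) → ℕ) →
    (∀ p₁ p₂ p₃ p₁₂ → new p₁ p₂ p₃ p₁₂ + (d₃ * p₃ + (d₁ + d₂ + d₃) * p₁₂ + u * p₁) ≡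
      (d₁ + d₃) * p₂ + (d₂ + d₃ + v) * p₁ + v′ * p₃ + u * p₁₂) →
    OddInsertion g s I k e o →
    let p₁ = g (inc₁ s); p₂ = g (inc₂ s); p₃ = g (inc₃ s); p₁₂ = g (inc₁ (inc₂ s)); r = bit (endsOdd s)
        t₁ = d₁ + odd↘even s; t₂ = d₂ + odd↗odd s; t₃ = d₃ + odd↘odd s in
    new p₁ p₂ p₃ p₁₂ + I + (t₃ * p₃ + (t₁ + t₂ + t₃ + r) * p₁₂ + (u + k) * p₁) ≡
    (t₁ + t₃ + r) * p₂ + (t₂ + t₃ + r + (v + e)) * p₁ + (v′ + o) * p₃ + (u + k) * p₁₂ +
    bit (not (endsOdd s)) * g (ending true s)
  extend g d₁ d₂ d₃ u v v′ new gap ih =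
    trans (left d₁ d₂ d₃ u (new p₁ p₂ p₃ p₁₂) p₁ p₃ p₁₂ t₁ t₂ t₃ r I k)
      (trans (cong₂ _+_ (gap p₁ p₂ p₃ p₁₂) ih)
        (right d₁ d₂ d₃ u v v′ p₁ p₂ p₃ p₁₂ _ t₁ t₂ t₃ r k e o))
    where
    p₁ = g (inc₁ s); p₂ = g (inc₂ s); p₃ = g (inc₃ s); p₁₂ = g (inc₁ (inc₂ s)); r = bit (endsOdd s)
    t₁ = odd↘even s; t₂ = odd↗odd s; t₃ = odd↘odd s
    left : ∀ d₁ d₂ d₃ u new p₁ p₃ p₁₂ t₁ t₂ t₃ r I k →
      new + I + ((d₃ + t₃) * p₃ + (d₁ + t₁ + (d₂ + t₂) + (d₃ + t₃) + r) * p₁₂ + (u + k) * p₁) ≡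
      new + (d₃ * p₃ + (d₁ + d₂ + d₃) * p₁₂ + u * p₁) +
      (I + (t₃ * p₃ + (t₁ + t₂ + t₃ + r) * p₁₂ + k * p₁))
    left = solve-∀
    right : ∀ d₁ d₂ d₃ u v v′ p₁ p₂ p₃ p₁₂ q t₁ t₂ t₃ r k e o →
      (d₁ + d₃) * p₂ + (d₂ + d₃ + v) * p₁ + v′ * p₃ + u * p₁₂ +
      ((t₁ + t₃ + r) * p₂ + (t₂ + t₃ + r + e) * p₁ + o * p₃ + k * p₁₂ + q) ≡
      (d₁ + t₁ + (d₃ + t₃) + r) * p₂ + (d₂ + t₂ + (d₃ + t₃) + r + (v + e)) * p₁ +
      (v′ + o) * p₃ + (u + k) * p₁₂ + q
    right = solve-∀

  go : ∀ b c d → OddInsertion (f ∘ link b c d) s I k e o →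
    OddInsertion f (link b c d s) (f (link b false false (link false c true s)) + I)
      (bit (not b) + k) (bit c + e) (bit (not c) + o)
  go false false false = extend (f ∘ inc₂) 0 1 0 1 0 1 (λ _ _ p₃ _ → p₃) gap
    where
    gap : ∀ p₁ p₂ p₃ p₁₂ → p₃ + (0 * p₃ + 1 * p₁₂ + 1 * p₁) ≡ 0 * p₂ + 1 * p₁ + 1 * p₃ + 1 * p₁₂
    gap = solve-∀
  go false false true = extend (f ∘ inc₃) 0 0 1 1 0 1 (λ _ p₂ _ _ → p₂) gap
    where
    gap : ∀ p₁ p₂ p₃ p₁₂ → p₂ + (1 * p₃ + 1 * p₁₂ + 1 * p₁) ≡ 1 * p₂ + 1 * p₁ + 1 * p₃ + 1 * p₁₂
    gap = solve-∀
  go false true false = extend f 0 0 0 1 1 0 (λ _ _ _ p₁₂ → p₁₂) gap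
    where
    gap : ∀ p₁ p₂ p₃ p₁₂ → p₁₂ + (0 * p₃ + 0 * p₁₂ + 1 * p₁) ≡ 0 * p₂ + 1 * p₁ + 0 * p₃ + 1 * p₁₂
    gap = solve-∀
  go false true true = extend (f ∘ inc₁) 1 0 0 1 1 0 (λ _ p₂ _ _ → p₂) gap
    where
    gap : ∀ p₁ p₂ p₃ p₁₂ → p₂ + (0 * p₃ + 1 * p₁₂ + 1 * p₁) ≡ 1 * p₂ + 1 * p₁ + 0 * p₃ + 1 * p₁₂
    gap = solve-∀
  go true false _ = extend f 0 0 0 0 0 1 (λ _ _ p₃ _ → p₃) gap
    where
    gap : ∀ p₁ p₂ p₃ p₁₂ → p₃ + (0 * p₃ + 0 * p₁₂ + 0 * p₁) ≡ 0 * p₂ + 0 * p₁ + 1 * p₃ + 0 * p₁₂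
    gap = solve-∀
  go true true _ = extend f 0 0 0 0 1 0 (λ p₁ _ _ _ → p₁) gap
    where
    gap : ∀ p₁ p₂ p₃ p₁₂ → p₁ + (0 * p₃ + 0 * p₁₂ + 0 * p₁) ≡ 0 * p₂ + 1 * p₁ + 0 * p₃ + 0 * p₁₂
    gap = solve-∀

edge-to-larger : ∀ {b x y} → does (even? x) ≡ b → y < x → edge y x ≡ link (does (even? y)) b false
edge-to-larger {y = y} e y<x = cong₂ (link (does (even? y))) e (dec-false (_ <? _) (ℕ.<-asym y<x))

edge-from-larger : ∀ {b x y} → does (even? x) ≡ b → y < x → edge x y ≡ link b (does (even? y)) true
edge-from-larger {y = y} e y<x = cong₂ (λ b → link b (does (even? y))) e (dec-true (_ <? _) y<x)

∑-inserts-∷ : ∀ (f : State → ℕ) {b x y z} w → does (even? x) ≡ b → y < x → z < x →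
  ∑ (inserts x (z ∷ w)) (f ∘ stateAfter y) ≡
  f (link (does (even? y)) b false (link b (does (even? z)) true (stateAfter z w))) +
  ∑ (inserts x w) (f ∘ edge y z ∘ stateAfter z)
∑-inserts-∷ f {z = z} w e y<x z<x = cong₂ _+_
  (cong₂ (λ g h → f (g (h (stateAfter z w)))) (edge-to-larger e y<x) (edge-from-larger e z<x))
  (∑-map _ (z ∷_) (inserts _ w))

∑-inserts-[] : ∀ (f : State → ℕ) {b x y} → does (even? x) ≡ b → y < x →
  ∑ (inserts x []) (f ∘ stateAfter y) ≡ f (link (does (even? y)) b false (state 0 0 0 (not b)))
∑-inserts-[] f e y<x = trans (ℕ.+-identityʳ _)
  (cong₂ (λ g b → f (g (state 0 0 0 (not b)))) (edge-to-larger e y<x) e)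

-- Sort the gaps by their neighbours. Behind an odd letter, a gap acts as `inc₃` inside an odd
-- ascent, as `inc₂` inside a descent or at the end, and as `inc₁ ∘ inc₂` before a larger even
-- letter. Behind an even letter, it acts as `inc₃` before an odd letter, as `inc₁` before an even
-- one, and as `ending true` at the end. Counting each type gives the coefficients; negative terms
-- stand on the left.
oddInsertion : ∀ f {x y} w → does (even? x) ≡ false → All (_< x) (y ∷ w) →
  OddInsertion f (stateAfter y w) (∑ (inserts x w) (f ∘ stateAfter y))
    (# odd? (y ∷ w)) (# even? w) (# odd? w)
oddInsertion f {x} {y} [] e (y<x ∷ []) rewrite ∑-inserts-[] f e y<x | #-∷ odd? y [] = base (does (even? y))
  where
  base : ∀ b → OddInsertion f (state 0 0 0 (not b)) (f (link b false false (state 0 0 0 true))) (bit (not b) + 0) 0 0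
  base true  = refl
  base false = rearrange (f (state 0 1 0 true)) (f (state 1 1 0 true)) (f (state 1 0 0 true))
    where
    rearrange : ∀ p₂ p₁₂ p₁ → p₂ + (1 * p₁₂ + 1 * p₁) ≡ 1 * p₂ + 1 * p₁ + 0 + 1 * p₁₂ + 0
    rearrange = solve-∀
oddInsertion f {x} {y} (z ∷ w) e (y<x ∷ z<x ∷ w<x)
  rewrite ∑-inserts-∷ f w e y<x z<x | #-∷ odd? y (z ∷ w) | #-∷ even? z w =
  subst (λ o → OddInsertion f (stateAfter y (z ∷ w)) (new + rest) (𝟙 (odd? y) + k) (𝟙 (even? z) + # even? w) o)
    (sym (#-∷ odd? z w))
    (oddInsertion-∷ (does (even? y)) (does (even? z)) (does (z <? y)) f (stateAfter z w) rest k (# even? w) (# odd? w)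
      (oddInsertion (f ∘ edge y z) w e (z<x ∷ w<x)))
  where
  new = f (link (does (even? y)) false false (link false (does (even? z)) true (stateAfter z w)))
  rest = ∑ (inserts x w) (f ∘ edge y z ∘ stateAfter z)
  k = # odd? (z ∷ w)

-- Insertion of a large even letter, and the balanced odd case.

-- When prepending a letter creates a counted pair, an `inc` meets a `dec` of the same counter. They
-- cancel unless the counter is 0, and then the coefficient kills the term.
restore₁ : ∀ (f : State → ℕ) s → odd↘even s * f (inc₁ (dec₁ s)) ≡ odd↘even s * f s
restore₁ f (state zero    _ _ _) = refl
restore₁ f (state (suc _) _ _ _) = refl

restore₂ : ∀ (f : State → ℕ) s → odd↗odd s * f (inc₂ (dec₂ s)) ≡ odd↗odd s * f s
restore₂ f (state _ zero    _ _) = refl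
restore₂ f (state _ (suc _) _ _) = refl

restore₃ : ∀ (f : State → ℕ) s → odd↘odd s * f (inc₃ (dec₃ s)) ≡ odd↘odd s * f s
restore₃ f (state _ _ zero    _) = refl
restore₃ f (state _ _ (suc _) _) = refl

evenInsertion-∷ : ∀ b c d f s I k → let g = f ∘ link b c d in
  I + evenLoss g s ≡ evenGain k g s →
  f (link b true false (link true c true s)) + I + evenLoss f (link b c d s) ≡
  evenGain (suc k) f (link b c d s)
evenInsertion-∷ b c d f s I k = go b c d
  where
  -- For the links that create a counted pair: `F` is the value with the pair intact, `n` the value
  -- when the new letter splits it.
  extend : ∀ n F q t {t′ w w′} → t′ ≡ suc t → w′ ≡ n + w →
    I + t * F ≡ k * F + w + q → n + I + t′ * F ≡ suc k * F + w′ + q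
  extend n F q t {w = w} refl refl ih =
    trans (left n F t I) (trans (cong (_+_ (n + F)) ih) (right n F q w k))
    where
    left : ∀ n F t I → n + I + (1 + t) * F ≡ n + F + (I + t * F)
    left = solve-∀
    right : ∀ n F q w k → n + F + (k * F + w + q) ≡ (1 + k) * F + (n + w) + q
    right = solve-∀

  unchanged : I + evenLoss f s ≡ evenGain k f s → f s + I + evenLoss f s ≡ evenGain (suc k) f s
  unchanged ih = trans (ℕ.+-assoc (f s) I _) (trans (cong (f s +_) ih) (rearrange (f s) (k * f s) _ _))
    where
    rearrange : ∀ n x y z → n + (x + y + z) ≡ n + x + y + z
    rearrange = solve-∀

  t₁ = odd↘even s; t₂ = odd↗odd s; t₃ = odd↘odd s

  go : ∀ b c d → let g = f ∘ link b c d in I + evenLoss g s ≡ evenGain k g s →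
    f (link b true false (link true c true s)) + I + evenLoss f (link b c d s) ≡
    evenGain (suc k) f (link b c d s)
  go false false false = extend (f s) (f (inc₂ s)) (f (inc₂ (ending false s))) (t₁ + t₂ + t₃)
    (cong (_+ t₃) (ℕ.+-suc t₁ t₂))
    (trans (rearrange (f s) (t₁ * f (inc₂ (dec₁ s))) (t₂ * f s) (t₃ * f (inc₂ (dec₃ s))))
      (cong (λ u → f s + (t₁ * f (inc₂ (dec₁ s)) + u + t₃ * f (inc₂ (dec₃ s)))) (sym (restore₂ f s))))
    where
    rearrange : ∀ n x y z → x + (n + y) + z ≡ n + (x + y + z)
    rearrange = solve-∀
  go false false true = extend (f s) (f (inc₃ s)) (f (inc₃ (ending false s))) (t₁ + t₂ + t₃)
    (ℕ.+-suc (t₁ + t₂) t₃)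
    (trans (rearrange (f s) (t₁ * f (inc₃ (dec₁ s))) (t₂ * f (inc₃ (dec₂ s))) (t₃ * f s))
      (cong (λ u → f s + (t₁ * f (inc₃ (dec₁ s)) + t₂ * f (inc₃ (dec₂ s)) + u)) (sym (restore₃ f s))))
    where
    rearrange : ∀ n x y z → x + y + (n + z) ≡ n + (x + y + z)
    rearrange = solve-∀
  go false true true = extend (f s) (f (inc₁ s)) (f (inc₁ (ending false s))) (t₁ + t₂ + t₃)
    refl
    (trans (rearrange (f s) (t₁ * f s) (t₂ * f (inc₁ (dec₂ s))) (t₃ * f (inc₁ (dec₃ s))))
      (cong (λ u → f s + (u + t₂ * f (inc₁ (dec₂ s)) + t₃ * f (inc₁ (dec₃ s)))) (sym (restore₁ f s))))
    where
    rearrange : ∀ n x y z → n + x + y + z ≡ n + (x + y + z)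
    rearrange = solve-∀
  go false true false = unchanged
  go true  _    _     = unchanged

-- A large even letter lies in no counted pair: as first entry it would have to be odd, as second
-- entry it would have to be smaller than its neighbour. An inner gap thus lowers the counter of the
-- pair it splits, if that pair is counted, and the last gap only resets the ending.
evenInsertion : ∀ f {x y} w → does (even? x) ≡ true → All (_< x) (y ∷ w) →
  ∑ (inserts x w) (f ∘ stateAfter y) + evenLoss f (stateAfter y w) ≡
  evenGain (length w) f (stateAfter y w)
evenInsertion f {x} {y} [] e (y<x ∷ []) rewrite ∑-inserts-[] f e y<x = base (does (even? y))
  where
  base : ∀ b → f (link b true false (state 0 0 0 false)) + 0 ≡ f (state 0 0 0 false)
  base true  = ℕ.+-identityʳ _
  base false = ℕ.+-identityʳ _
evenInsertion f {x} {y} (z ∷ w) e (y<x ∷ z<x ∷ w<x) rewrite ∑-inserts-∷ f w e y<x z<x =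
  evenInsertion-∷ (does (even? y)) (does (even? z)) (does (z <? y)) f (stateAfter z w) _ (length w)
    (evenInsertion (f ∘ edge y z) w e (z<x ∷ w<x))

-- In the general identity, `f (inc₁ s)` carries an extra `e` on one side and `k` on the other. For
-- equal numbers these cancel, and the symmetric form `oddGain` remains.
balancedInsertion : ∀ f {x k} w → does (even? x) ≡ false → All (_< x) (0 ∷ w) →
  # odd? w ≡ k → # even? w ≡ k →
  ∑ (inserts x w) (f ∘ wordState) + oddLoss f (wordState w) ≡ oddGain k f (wordState w)
balancedInsertion f {x} {k} w e w<x o≡k e≡k = ℕ.+-cancelʳ-≡ (k * f (inc₁ s)) _ _
  (trans (ℕ.+-assoc I _ _) (trans identity
    (rearrange ((t₁ + t₃ + r) * f (inc₂ s)) (f (inc₁ s)) (k * f (inc₃ s)) _ _ (t₂ + t₃ + r) k)))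
  where
  s = wordState w
  t₁ = odd↘even s; t₂ = odd↗odd s; t₃ = odd↘odd s; r = bit (endsOdd s)
  I = ∑ (inserts x w) (f ∘ wordState)
  -- Since 0 is even, `# odd? (0 ∷ w)` reduces to `# odd? w`, so all three counts become `k`.
  identity : OddInsertion f s I k k k
  identity = subst (λ o → OddInsertion f s I o k o) o≡k
    (subst (λ m → OddInsertion f s I (# odd? w) m (# odd? w)) e≡k
      (oddInsertion f w e w<x))
  rearrange : ∀ a p b c q u k → a + (u + k) * p + b + c + q ≡ a + u * p + b + c + q + k * p
  rearrange = solve-∀

-- Parities of the letters.

even⊎even-suc : ∀ n → Even n ⊎ Even (suc n)
even⊎even-suc zero    = inj₁ (2 ∣.∣0)
even⊎even-suc (suc n) with even⊎even-suc n
... | inj₁ 2∣n   = inj₂ (∣.∣m∣n⇒∣m+n ∣.∣-refl 2∣n)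
... | inj₂ 2∣1+n = inj₁ 2∣1+n

even⇒odd-suc : ∀ n → Even n → Odd (suc n)
even⇒odd-suc n 2∣n 2∣1+n
  with () ← ∣.∣1⇒≡1 (∣.∣m+n∣m⇒∣n (subst (2 ∣.∣_) (ℕ.+-comm 1 n) 2∣1+n) 2∣n)

even?-suc : ∀ n → does (even? (suc n)) ≡ not (does (even? n))
even?-suc n with even⊎even-suc n
... | inj₁ 2∣n   = trans (dec-false (even? (suc n)) (even⇒odd-suc n 2∣n)) (sym (cong not (dec-true (even? n) 2∣n)))
... | inj₂ 2∣1+n = trans (dec-true (even? (suc n)) 2∣1+n)
                     (sym (cong not (dec-false (even? n) λ 2∣n → even⇒odd-suc n 2∣n 2∣1+n)))

#odd-letters : ∀ n → # odd? (letters n) ≡ # even? (letters n) + 𝟙 (odd? n)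
#odd-letters zero    = refl
#odd-letters (suc n)
  rewrite #-∷ odd? (suc n) (letters n) | #-∷ even? (suc n) (letters n) | #odd-letters n | even?-suc n =
  rearrange (does (even? n)) (# even? (letters n))
  where
  rearrange : ∀ b e → bit (not (not b)) + (e + bit (not b)) ≡ bit (not b) + e + bit (not (not b))
  rearrange true  e = trans (cong suc (ℕ.+-identityʳ e)) (ℕ.+-comm 1 e)
  rearrange false e = trans (ℕ.+-comm e 1) (sym (ℕ.+-identityʳ (suc e)))

#-↭ : {P : Pred A ℓ} (P? : Decidable P) {xs ys : List A} → xs ↭ ys → # P? xs ≡ # P? ys
#-↭ P? e = ↭-length (filter-↭ P? e)

-- Words whose small letters appear in order.

-- A violation `x > y` with `x ≤ d` has `y ≤ d` as well, so bounding the earlier letter is enough.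
Ordered : ℕ → List ℕ → Set
Ordered d = AllPairs (λ x y → x ≤ d → x ≤ y)

ordered? : ∀ d → Decidable (Ordered d)
ordered? d = AllPairs.allPairs? (λ x y → x ≤? d →-dec x ≤? y)

inOrder⇔ordered : (p : Permutation′ n) (d : ℕ) → InOrder p d ⇔ Ordered d (word p)
inOrder⇔ordered {n} p d = mk⇔ to from
  where
  to : InOrder p d → Ordered d (word p)
  to ord = AllPairs.tabulate⁺-< λ {i} {j} i<j pᵢ≤d →
    ℕ.≮⇒≥ λ pⱼ<pᵢ → ℕ.<-asym i<j (ord j i pⱼ<pᵢ pᵢ≤d)
  from : Ordered d (word p) → InOrder p d
  from ord i j pᵢ<pⱼ pⱼ≤d with Fin.<-cmp i j
  ... | tri< i<j _ _  = i<j
  ... | tri≈ _ refl _ = contradiction pᵢ<pⱼ (ℕ.<-irrefl refl)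
  ... | tri> _ _ j<i  = contradiction (AllPairs-tabulate⁻ ord j<i pⱼ≤d) (ℕ.<⇒≱ pᵢ<pⱼ)

-- `InOrder p` is downward closed in the bound, so the maximum reaches `d` exactly when `d` itself
-- qualifies. Beyond `suc m` this fails, as the identity shows.
≤S₁₇⇔inOrder : ∀ {m} (p : Permutation′ (suc m)) {d} → d ≤ suc m → d ≤ S₁₇ p ⇔ InOrder p d
≤S₁₇⇔inOrder {m} p {d} d≤n = mk⇔ to (from d d≤n)
  where
  to : d ≤ S₁₇ p → InOrder p d
  to d≤S i j pᵢ<pⱼ pⱼ≤d = proj₂ (proj₂ (S₁₇-inOrder p)) i j pᵢ<pⱼ (ℕ.≤-trans pⱼ≤d d≤S)
  from : ∀ d → d ≤ suc m → InOrder p d → d ≤ S₁₇ p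
  from zero    _   _   = z≤n
  from (suc d) d<n ord = S₁₇-maximal p (s≤s z≤n) d<n ord

-- Pairs that contain `x` satisfy `R` wherever `x` stands, so only the pairs within `ys` matter, and
-- these keep their order.
AllPairs-inserts : {R : A → A → Set ℓ} {x : A} (ys : List A) {zs : List A} →
  All (R x) ys → All (λ y → R y x) ys → zs ∈ inserts x ys → AllPairs R zs ⇔ AllPairs R ys
AllPairs-inserts []       []       []       (here refl) = mk⇔ (λ _ → []) (λ _ → [] ∷ [])
AllPairs-inserts (y ∷ ys) Rxys     Rysx     (here refl) = mk⇔ AllPairs.tail (Rxys ∷_)
AllPairs-inserts {R = R} {x} (y ∷ ys) (_ ∷ Rxys) (Ryx ∷ Rysx) (there zs∈)
  with zs , zs∈ , refl ← ∈-map⁻ (y ∷_) zs∈ = mk⇔ to from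
  where
  ih = AllPairs-inserts {R = R} ys Rxys Rysx zs∈
  zs↭ = ∈-inserts⁻ ys zs∈
  to : AllPairs R (y ∷ zs) → AllPairs R (y ∷ ys)
  to (Ryzs ∷ Rzs) = All.tail (All-resp-↭ zs↭ Ryzs) ∷ Equivalence.to ih Rzs
  from : AllPairs R (y ∷ ys) → AllPairs R (y ∷ zs)
  from (Ryys ∷ Rys) = All-resp-↭ (↭-sym zs↭) (Ryx ∷ Ryys) ∷ Equivalence.from ih Rys

letters-< : ∀ n {w} → w ∈ rearrangements (letters n) → All (_< suc n) w
letters-< n w∈ = All-resp-↭ (↭-sym (∈-rearrangements⁻ (letters n) w∈)) (All.applyDownFrom⁺₁ suc n s≤s)

-- Exchange invariance and its propagation to the next letter.

weightedSum : (d n : ℕ) → (State → ℕ) → ℕ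
weightedSum d n f = ∑ (rearrangements (letters n)) (λ w → 𝟙 (ordered? d w) * f (wordState w))

weightedSum-cong : ∀ d n {f g} → (∀ s → f s ≡ g s) → weightedSum d n f ≡ weightedSum d n g
weightedSum-cong d n e = ∑-cong (rearrangements (letters n)) (λ {w} _ → cong (𝟙 (ordered? d w) *_) (e (wordState w)))

weightedSum-suc : ∀ {d n} f → d ≤ n → weightedSum d (suc n) f ≡
  ∑ (rearrangements (letters n)) (λ w → 𝟙 (ordered? d w) * ∑ (inserts (suc n) w) (f ∘ wordState))
weightedSum-suc {d} {n} f d≤n =
  trans (∑-concatMap _ (inserts (suc n)) (rearrangements (letters n)))
    (∑-cong (rearrangements (letters n)) λ {w} w∈ →
      trans (∑-cong (inserts (suc n) w) λ {w′} w′∈ → cong (_* f (wordState w′))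
              -- The letter `suc n` exceeds `d`, so the condition is vacuous when it comes first;
              -- when it comes second it is the larger letter.
              (𝟙-⇔ (AllPairs-inserts w (All.map (λ _ 1+n≤d → contradiction d≤n (ℕ.<⇒≱ 1+n≤d)) (letters-< n w∈))
                      (All.map (λ y<1+n _ → ℕ.<⇒≤ y<1+n) (letters-< n w∈)) w′∈)
                (ordered? d w′) (ordered? d w)))
        (∑-* (𝟙 (ordered? d w)) (f ∘ wordState) (inserts (suc n) w)))

-- Quantifying over all `f` expresses equidistribution and lets the induction hypothesis be applied
-- to `loss f` and `gain f`.
ExchangeInvariant : (d n : ℕ) → Set
ExchangeInvariant d n = ∀ f → weightedSum d n (f ∘ exchange) ≡ weightedSum d n f

-- The new sum plus the old sum of `loss f` is the old sum of `gain f`. Invariance of the two old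
-- sums gives that of the new one after cancellation, which replaces subtraction in `ℕ`.
exchangeInvariant-suc : ∀ {d n} → d ≤ n → (loss gain : (State → ℕ) → State → ℕ) →
  (∀ f s → loss (f ∘ exchange) s ≡ loss f (exchange s)) →
  (∀ f s → gain (f ∘ exchange) s ≡ gain f (exchange s)) →
  (∀ f {w} → w ∈ rearrangements (letters n) →
    ∑ (inserts (suc n) w) (f ∘ wordState) + loss f (wordState w) ≡ gain f (wordState w)) →
  ExchangeInvariant d n → ExchangeInvariant d (suc n)
exchangeInvariant-suc {d} {n} d≤n loss gain loss-exchange gain-exchange insertion invariant f =
  ℕ.+-cancelʳ-≡ (weightedSum d n (loss f)) _ _ (begin
    weightedSum d (suc n) (f ∘ exchange) + weightedSum d n (loss f)
      ≡⟨ cong (weightedSum d (suc n) (f ∘ exchange) +_) (invariant (loss f)) ⟨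
    weightedSum d (suc n) (f ∘ exchange) + weightedSum d n (loss f ∘ exchange)
      ≡⟨ cong (weightedSum d (suc n) (f ∘ exchange) +_) (weightedSum-cong d n (loss-exchange f)) ⟨
    weightedSum d (suc n) (f ∘ exchange) + weightedSum d n (loss (f ∘ exchange))
      ≡⟨ recurrence (f ∘ exchange) ⟩
    weightedSum d n (gain (f ∘ exchange))
      ≡⟨ weightedSum-cong d n (gain-exchange f) ⟩
    weightedSum d n (gain f ∘ exchange)
      ≡⟨ invariant (gain f) ⟩
    weightedSum d n (gain f)
      ≡⟨ recurrence f ⟨
    weightedSum d (suc n) f + weightedSum d n (loss f) ∎)
  where
  open ≡-Reasoning
  recurrence : ∀ f → weightedSum d (suc n) f + weightedSum d n (loss f) ≡ weightedSum d n (gain f)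
  recurrence f = trans (cong (_+ weightedSum d n (loss f)) (weightedSum-suc f d≤n))
    (trans (sym (∑-+ _ _ (rearrangements (letters n))))
      (∑-cong (rearrangements (letters n)) λ {w} w∈ →
        trans (sym (ℕ.*-distribˡ-+ (𝟙 (ordered? d w)) _ _)) (cong (𝟙 (ordered? d w) *_) (insertion f w∈))))

-- The base word, and the induction over all letters.

-- Consecutive numbers have opposite parity and ascend, while a counted pair of opposite parity
-- descends.
edge-suc : ∀ x s → edge x (suc x) s ≡ s
edge-suc x s rewrite even?-suc x | dec-false (suc x <? x) (ℕ.<-asym (ℕ.n<1+n x)) = unchanged (does (even? x))
  where
  unchanged : ∀ b → link b (not b) false s ≡ s
  unchanged true  = refl
  unchanged false = refl

-- A general `f` is taken because `applyUpTo` recurses to `f ∘ suc`.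
stateAfter-consecutive : ∀ (f : ℕ → ℕ) x n → f 0 ≡ suc x → (∀ i → f (suc i) ≡ suc (f i)) →
  ∃ λ b → stateAfter x (applyUpTo f n) ≡ state 0 0 0 b
stateAfter-consecutive f x zero    f0 fsuc = _ , refl
stateAfter-consecutive f x (suc n) f0 fsuc rewrite f0
  with b , e ← stateAfter-consecutive (f ∘ suc) (suc x) n (trans (fsuc 0) (cong suc f0)) (fsuc ∘ suc) =
  b , trans (edge-suc x _) e

-- All letters are at most `d`, so `w` is sorted; two sorted rearrangements of the same list
-- coincide.
ordered⇒applyUpTo : ∀ {d w} → w ∈ rearrangements (letters d) → Ordered d w → w ≡ applyUpTo suc d
ordered⇒applyUpTo {d} {w} w∈ ord = Pointwise-≡⇒≡ (↗↭↗⇒≋ ℕ.≤-totalOrder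
  (AllPairs⇒Sorted ℕ.≤-totalOrder (increasing (letters-< d w∈) ord))
  (applyUpTo⁺₂ ℕ.≤-totalOrder suc d (ℕ.n≤1+n ∘ suc))
  (↭⇒↭ₛ (↭-trans (∈-rearrangements⁻ (letters d) w∈)
    (↭-trans (↭-reflexive (sym (reverse-applyUpTo suc d))) (↭-reverse (applyUpTo suc d))))))
  where
  increasing : ∀ {w} → All (_< suc d) w → Ordered d w → AllPairs _≤_ w
  increasing []             []           = []
  increasing (s≤s x≤d ∷ w<) (Rxw ∷ ord) = All.map (λ x≤y → x≤y x≤d) Rxw ∷ increasing w< ord

-- Only the increasing word has nonzero weight, and its counters are all 0, so `exchange` fixes its
-- state.
exchangeInvariant-base : ∀ d → ExchangeInvariant d d
exchangeInvariant-base d f = ∑-cong (rearrangements (letters d)) λ {w} w∈ → fixed w w∈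
  where
  fixed : ∀ w → w ∈ rearrangements (letters d) →
    𝟙 (ordered? d w) * f (exchange (wordState w)) ≡ 𝟙 (ordered? d w) * f (wordState w)
  fixed w w∈ with ordered? d w
  ... | no  _   = refl
  ... | yes ord rewrite ordered⇒applyUpTo w∈ ord
    with b , e ← stateAfter-consecutive suc 0 d refl (λ _ → refl) rewrite e = refl

exchangeInvariant-step : ∀ {d n} → d ≤ n → ExchangeInvariant d n → ExchangeInvariant d (suc n)
exchangeInvariant-step {d} {n} d≤n with does (even? (suc n)) in even
... | true  = exchangeInvariant-suc d≤n evenLoss (evenGain n) evenLoss-exchange (evenGain-exchange n)
  λ f {w} w∈ → subst (λ k → ∑ (inserts (suc n) w) (f ∘ wordState) + evenLoss f (wordState w) ≡ evenGain k f (wordState w))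
    (trans (↭-length (∈-rearrangements⁻ (letters n) w∈)) (length-applyDownFrom suc n))
    (evenInsertion f w even (s≤s z≤n ∷ letters-< n w∈))
-- Here `suc n` is odd, so `n` is even and the letters up to `n` comprise `k` odd and `k` even ones.
... | false = exchangeInvariant-suc d≤n oddLoss (oddGain k) oddLoss-exchange (oddGain-exchange k)
  λ f {w} w∈ → balancedInsertion f w even (s≤s z≤n ∷ letters-< n w∈)
    (trans (#-↭ odd? (∈-rearrangements⁻ (letters n) w∈)) balanced)
    (#-↭ even? (∈-rearrangements⁻ (letters n) w∈))
  where
  k = # even? (letters n)
  balanced : # odd? (letters n) ≡ k
  balanced = trans (#odd-letters n)
    (trans (cong (λ b → k + bit b) (trans (sym (even?-suc n)) even)) (ℕ.+-identityʳ k))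

exchangeInvariant : ∀ {d n} → d ≤ n → ExchangeInvariant d n
exchangeInvariant {d} d≤n = go (ℕ.≤⇒≤′ d≤n)
  where
  go : ∀ {n} → d ≤′ n → ExchangeInvariant d n
  go ≤′-refl = exchangeInvariant-base d
  go (≤′-step d≤′n)      = exchangeInvariant-step (ℕ.≤′⇒≤ d≤′n) (go d≤′n)

#-adjacent : ∀ {R : ℕ → ℕ → Set} (R? : ∀ x y → Dec (R x y)) (π : State → ℕ) →
  (∀ b → π (state 0 0 0 b) ≡ 0) →
  (∀ {x y} s → x ≢ y → π (edge x y s) ≡ 𝟙 (R? x y) + π s) →
  ∀ {m} (f : Fin (suc m) → ℕ) → (∀ {i j} → f i ≡ f j → i ≡ j) →
  # (λ i → R? (f (inject₁ i)) (f (suc i))) (allFin m) ≡ π (stateAfter (f zero) (tabulate (f ∘ suc)))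
#-adjacent R? π π0 πedge {zero}  f f-inj = sym (π0 _)
#-adjacent R? π π0 πedge {suc m} f f-inj = begin
  # P? (zero ∷ tabulate suc)                                ≡⟨ #-∷ P? zero (tabulate suc) ⟩
  𝟙 (P? zero) + # P? (tabulate suc)                         ≡⟨ cong (λ is → 𝟙 (P? zero) + # P? is) (map-tabulate (λ i → i) suc) ⟨
  𝟙 (P? zero) + # P? (map suc (allFin m))                   ≡⟨ cong (𝟙 (P? zero) +_) (#-map P? suc (allFin m)) ⟩
  𝟙 (P? zero) + # (P? ∘ suc) (allFin m)                     ≡⟨ cong (𝟙 (P? zero) +_) (#-adjacent R? π π0 πedge (f ∘ suc) (Fin.suc-injective ∘ f-inj)) ⟩
  𝟙 (P? zero) + π (stateAfter (f (suc zero)) (tabulate (λ i → f (suc (suc i)))))  ≡⟨ πedge _ (λ e → Fin.0≢1+n (f-inj e)) ⟨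
  π (stateAfter (f zero) (tabulate (f ∘ suc)))              ∎
  where
  open ≡-Reasoning
  P? = λ i → R? (f (inject₁ i)) (f (suc i))

-- The statistics of a permutation as counters of its state.

permutationState : Permutation′ n → State
permutationState = wordState ∘ word

module _ {m} (p : Permutation′ (suc m)) where
  T₁-word : T₁ p ≡ odd↘even (permutationState p)
  -- As 0 is even, `edge 0` reduces to the identity, so the leading 0 in `wordState` disappears.
  T₁-word = #-adjacent (λ x y → y <? x ×-dec odd? x ×-dec even? y) odd↘even (λ _ → refl)
    (λ {x} {y} s _ → contribution (does (even? x)) (does (even? y)) (does (y <? x)) s) (letter p) (letter-injective p)
    where
    contribution : ∀ b c d s → odd↘even (link b c d s) ≡ bit (d ∧ not b ∧ c) + odd↘even s
    contribution false false false s = refl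
    contribution false false true  s = refl
    contribution false true  false s = refl
    contribution false true  true  s = refl
    contribution true  c     false s = refl
    contribution true  c     true  s = refl

  T₂-word : T₂ p ≡ odd↗odd (permutationState p)
  T₂-word = #-adjacent (λ x y → x <? y ×-dec odd? x ×-dec odd? y) odd↗odd (λ _ → refl)
    -- `link` records only `y < x`; the ascent `x < y` is its negation because adjacent letters are
    -- distinct.
    (λ {x} {y} s x≢y → trans (contribution (does (even? x)) (does (even? y)) (does (y <? x)) s)
      (cong (λ d → bit (d ∧ does (odd? x) ∧ does (odd? y)) + odd↗odd s) (sym (<?-flip x≢y))))
    (letter p) (letter-injective p)
    where
    <?-flip : ∀ {x y} → x ≢ y → does (x <? y) ≡ not (does (y <? x))
    <?-flip {x} {y} x≢y with ℕ.<-cmp x y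
    ... | tri< x<y _ x≯y = trans (dec-true (x <? y) x<y) (sym (cong not (dec-false (y <? x) x≯y)))
    ... | tri≈ _ x≡y _   = contradiction x≡y x≢y
    ... | tri> x≮y _ y<x = trans (dec-false (x <? y) x≮y) (sym (cong not (dec-true (y <? x) y<x)))
    contribution : ∀ b c d s → odd↗odd (link b c d s) ≡ bit (not d ∧ not b ∧ not c) + odd↗odd s
    contribution false false false s = refl
    contribution false false true  s = refl
    contribution false true  false s = refl
    contribution false true  true  s = refl
    contribution true  c     false s = refl
    contribution true  c     true  s = refl

  T₃-word : T₃ p ≡ odd↘odd (permutationState p)
  T₃-word = #-adjacent (λ x y → y <? x ×-dec odd? x ×-dec odd? y) odd↘odd (λ _ → refl)
    (λ {x} {y} s _ → contribution (does (even? x)) (does (even? y)) (does (y <? x)) s) (letter p) (letter-injective p)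
    where
    contribution : ∀ b c d s → odd↘odd (link b c d s) ≡ bit (d ∧ not b ∧ not c) + odd↘odd s
    contribution false false false s = refl
    contribution false false true  s = refl
    contribution false true  false s = refl
    contribution false true  true  s = refl
    contribution true  c     false s = refl
    contribution true  c     true  s = refl

-- Transfer to the symmetric group and isolation of one value of `S₁₇`.

∑-𝔖 : ∀ m {d} (f : State → ℕ) → d ≤ suc m →
  ∑ (𝔖 (suc m)) (λ p → 𝟙 (d ≤? S₁₇ p) * f (permutationState p)) ≡ weightedSum d (suc m) f
∑-𝔖 m {d} f d≤n = begin
  ∑ (𝔖 (suc m)) (λ p → 𝟙 (d ≤? S₁₇ p) * f (permutationState p))
    ≡⟨ ∑-cong (𝔖 (suc m)) (λ {p} _ → cong (_* f (permutationState p))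
         (𝟙-⇔ (inOrder⇔ordered p d ⇔-∘ ≤S₁₇⇔inOrder p d≤n) (d ≤? S₁₇ p) (ordered? d (word p)))) ⟩
  ∑ (𝔖 (suc m)) (λ p → 𝟙 (ordered? d (word p)) * f (permutationState p))
    ≡⟨ ∑-map (λ w → 𝟙 (ordered? d w) * f (wordState w)) word (𝔖 (suc m)) ⟨
  ∑ (map word (𝔖 (suc m))) (λ w → 𝟙 (ordered? d w) * f (wordState w))
    ≡⟨ ∑-↭ _ (words↭rearrangements (suc m)) ⟩
  weightedSum d (suc m) f ∎
  where open ≡-Reasoning

exchange-≤S₁₇ : ∀ m d (f : State → ℕ) →
  ∑ (𝔖 (suc m)) (λ p → 𝟙 (d ≤? S₁₇ p) * f (exchange (permutationState p))) ≡
  ∑ (𝔖 (suc m)) (λ p → 𝟙 (d ≤? S₁₇ p) * f (permutationState p))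
exchange-≤S₁₇ m d f with d ≤? suc m
... | yes d≤n = trans (∑-𝔖 m (f ∘ exchange) d≤n) (trans (exchangeInvariant d≤n f) (sym (∑-𝔖 m f d≤n)))
-- `S₁₇` is at most `suc m`, so for larger `d` both sums vanish.
... | no  d≰n = ∑-cong (𝔖 (suc m)) λ {p} _ →
  trans (cong (_* f (exchange (permutationState p))) (vanishes p))
    (sym (cong (_* f (permutationState p)) (vanishes p)))
  where
  vanishes : ∀ p → 𝟙 (d ≤? S₁₇ p) ≡ 0
  vanishes p = cong bit (dec-false (d ≤? S₁₇ p) λ d≤S → d≰n (ℕ.≤-trans d≤S (proj₁ (proj₂ (S₁₇-inOrder p)))))

𝟙≤≡𝟙≡+𝟙< : ∀ m n → 𝟙 (m ≤? n) ≡ 𝟙 (m ≟ n) + 𝟙 (m <? n)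
𝟙≤≡𝟙≡+𝟙< m n with ℕ.<-cmp m n
... | tri< m<n m≢n _ = trans (cong bit (dec-true (m ≤? n) (ℕ.<⇒≤ m<n)))
  (sym (cong₂ (λ b c → bit b + bit c) (dec-false (m ≟ n) m≢n) (dec-true (m <? n) m<n)))
... | tri≈ m≮n m≡n _ = trans (cong bit (dec-true (m ≤? n) (ℕ.≤-reflexive m≡n)))
  (sym (cong₂ (λ b c → bit b + bit c) (dec-true (m ≟ n) m≡n) (dec-false (m <? n) m≮n)))
... | tri> m≮n m≢n n<m = trans (cong bit (dec-false (m ≤? n) (ℕ.<⇒≱ n<m)))
  (sym (cong₂ (λ b c → bit b + bit c) (dec-false (m ≟ n) m≢n) (dec-false (m <? n) m≮n)))

-- The indicator of `S₁₇ = d` is the difference of those of `S₁₇ ≥ d` and `S₁₇ ≥ suc d`; the latter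
-- sum is added to both sides and cancelled.
exchange-S₁₇ : ∀ m d (f : State → ℕ) →
  ∑ (𝔖 (suc m)) (λ p → 𝟙 (d ≟ S₁₇ p) * f (exchange (permutationState p))) ≡
  ∑ (𝔖 (suc m)) (λ p → 𝟙 (d ≟ S₁₇ p) * f (permutationState p))
exchange-S₁₇ m d f = ℕ.+-cancelʳ-≡ (∑ (𝔖 (suc m)) (λ p → 𝟙 (d <? S₁₇ p) * f (permutationState p))) _ _
  (trans (cong (∑ (𝔖 (suc m)) (λ p → 𝟙 (d ≟ S₁₇ p) * f (exchange (permutationState p))) +_)
      (sym (exchange-≤S₁₇ m (suc d) f)))
    (trans (split (f ∘ exchange)) (trans (exchange-≤S₁₇ m d f) (sym (split f)))))
  where
  split : ∀ g → ∑ (𝔖 (suc m)) (λ p → 𝟙 (d ≟ S₁₇ p) * g (permutationState p)) +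
    ∑ (𝔖 (suc m)) (λ p → 𝟙 (d <? S₁₇ p) * g (permutationState p)) ≡
    ∑ (𝔖 (suc m)) (λ p → 𝟙 (d ≤? S₁₇ p) * g (permutationState p))
  split g = trans (sym (∑-+ _ _ (𝔖 (suc m)))) (∑-cong (𝔖 (suc m)) λ {p} _ →
    trans (sym (ℕ.*-distribʳ-+ (g (permutationState p)) (𝟙 (d ≟ S₁₇ p)) (𝟙 (d <? S₁₇ p))))
      (cong (_* g (permutationState p)) (sym (𝟙≤≡𝟙≡+𝟙< d (S₁₇ p)))))

theorem1p3 : (m : ℕ) (a b c d : ℤ) →
    # (λ p → ⟨ T₁ , T₂ , T₃ , S₁₇ ⟩ p ≟⁴ (a , b , c , d)) (𝔖 (suc m)) ≡
    # (λ p → ⟨ T₂ , T₁ , T₃ , S₁₇ ⟩ p ≟⁴ (a , b , c , d)) (𝔖 (suc m))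
theorem1p3 m a b c d = begin
  # (λ p → ⟨ T₁ , T₂ , T₃ , S₁₇ ⟩ p ≟⁴ (a , b , c , d)) (𝔖 (suc m))
    ≡⟨ #≡∑ _ (𝔖 (suc m)) ⟩
  ∑ (𝔖 (suc m)) (λ p → 𝟙 (⟨ T₁ , T₂ , T₃ , S₁₇ ⟩ p ≟⁴ (a , b , c , d)))
    ≡⟨ ∑-cong (𝔖 (suc m)) (λ {p} _ → trans (isolate (T₁ p) (T₂ p) (T₃ p) (S₁₇ p)) (cong (𝟙 (∣ d ∣ ≟ S₁₇ p) *_) (in-state p))) ⟩
  ∑ (𝔖 (suc m)) (λ p → 𝟙 (∣ d ∣ ≟ S₁₇ p) * f (permutationState p))
    ≡⟨ exchange-S₁₇ m ∣ d ∣ f ⟨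
  ∑ (𝔖 (suc m)) (λ p → 𝟙 (∣ d ∣ ≟ S₁₇ p) * f (exchange (permutationState p)))
    ≡⟨ ∑-cong (𝔖 (suc m)) (λ {p} _ → trans (isolate (T₂ p) (T₁ p) (T₃ p) (S₁₇ p)) (cong (𝟙 (∣ d ∣ ≟ S₁₇ p) *_) (in-exchanged p))) ⟨
  ∑ (𝔖 (suc m)) (λ p → 𝟙 (⟨ T₂ , T₁ , T₃ , S₁₇ ⟩ p ≟⁴ (a , b , c , d)))
    ≡⟨ #≡∑ _ (𝔖 (suc m)) ⟨
  # (λ p → ⟨ T₂ , T₁ , T₃ , S₁₇ ⟩ p ≟⁴ (a , b , c , d)) (𝔖 (suc m)) ∎
  where
  open ≡-Reasoning

  hit : (i j k l : ℕ) → ℕ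
  hit i j k l = 𝟙 ((ℤ.+_ i , ℤ.+_ j , ℤ.+_ k , ℤ.+_ l) ≟⁴ (a , b , c , d))

  -- Fixing the last coordinate at `∣ d ∣` makes this a function of the state alone. For negative
  -- `d` it is 0, since no natural number embeds as `d`.
  f : State → ℕ
  f s = hit (odd↘even s) (odd↗odd s) (odd↘odd s) ∣ d ∣

  hit-cong : ∀ {i i′ j j′ k k′ l} → i ≡ i′ → j ≡ j′ → k ≡ k′ → hit i j k l ≡ hit i′ j′ k′ l
  hit-cong refl refl refl = refl

  in-state : (p : Permutation′ (suc m)) → hit (T₁ p) (T₂ p) (T₃ p) ∣ d ∣ ≡ f (permutationState p)
  in-state p = hit-cong (T₁-word p) (T₂-word p) (T₃-word p)

  in-exchanged : (p : Permutation′ (suc m)) → hit (T₂ p) (T₁ p) (T₃ p) ∣ d ∣ ≡ f (exchange (permutationState p))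
  in-exchanged p = hit-cong (T₂-word p) (T₁-word p) (T₃-word p)

  isolate : ∀ i j k l → hit i j k l ≡ 𝟙 (∣ d ∣ ≟ l) * hit i j k ∣ d ∣
  isolate i j k l = go (∣ d ∣ ≟ l)
    where
    go : (d≟l : Dec (∣ d ∣ ≡ l)) → hit i j k l ≡ 𝟙 d≟l * hit i j k ∣ d ∣
    go (yes refl)  = sym (ℕ.+-identityʳ _)
    go (no ∣d∣≢l) = cong bit
      (dec-false ((ℤ.+_ i , ℤ.+_ j , ℤ.+_ k , ℤ.+_ l) ≟⁴ (a , b , c , d)) λ { refl → ∣d∣≢l refl })
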